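{- For all integers $r\ge 2$ and $n\ge 1$, $\mathrm{sat}^{(r)}_{\mathsf p}(n,n)=|\mathcal P_r(n)|$.
   Context: Let $\mathcal P_2(n)=[n]^2=\{1,\dots,n\}^2$, partially ordered by $(x_1,x_2)\subseteq(y_1,y_2)$ iff $x_1\le y_1$ and $x_2\le y_2$. For $k\ge 3$, $\mathcal P_k(n)$ is the family of all subsets $\mathcal F\subseteq\mathcal P_{k-1}(n)$ that are down-closed (i.e., $S\in\mathcal F$ and $S'\subseteq S$ imply $S'\in\mathcal F$), partially ordered by inclusion. Consider $r$-uniform complete hypergraphs $H$ whose vertex set is linearly ordered and each of whose edges is colored red or blue. A monotone path of length $k$ consists of vertices $v_1<\dots<v_{k+r-1}$ and edges $\{v_i,\dots,v_{i+r-1}\}$, $i=1,\dots,k$; it is red (blue) if all its edges are red (blue). $H$ is $(k,\ell)$-path-free if it has no red monotone path of length $k$ and no blue monotone path of length $\ell$. $H$ is $(k,\ell)$-path-saturated if it is $(k,\ell)$-path-free and every red/blue-colored vertex-ordered $r$-uniform complete hypergraph $H^+$ properly containing $H$ (preserving order and colors) contains a red monotone path of length $k$ or a blue monotone path of length $\ell$. $\mathrm{sat}^{(r)}_{\mathsf p}(k,\ell)$ is the minimum number of vertices of a $(k,\ell)$-path-saturated such hypergraph. -}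

module Defs where

open import Data.Nat using (ℕ; zero; suc; _+_; _*_; _∸_; _≤_; _<_; _≤ᵇ_)
open import Data.Bool using (Bool; true; false; _∧_; _∨_; not)
open import Data.Fin using (Fin; toℕ)
import Data.Fin as F
open import Data.List using (List; []; _∷_; map; concatMap; filter; length; zip; upTo)
open import Data.Vec using (Vec; lookup; tabulate)
import Data.Vec as V
open import Data.Product using (Σ; _×_; _,_; ∃)
open import Data.Sum using (_⊎_)
open import Relation.Nullary using (¬_)
open import Relation.Binary.PropositionalEquality using (_≡_)
open import Data.Bool.Properties using (T?)

-- A finite poset given by an explicit (duplicate-free) enumeration of its
-- elements and a Boolean order relation.
record FinPoset : Set₁ where
  field
    Elem  : Set
    elems : List Elem
    leq   : Elem → Elem → Bool

open FinPoset public

range1 : ℕ → List ℕ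
range1 n = map suc (upTo n)

grid : ℕ → FinPoset
grid n = record
  { Elem  = ℕ × ℕ
  ; elems = concatMap (λ a → map (λ b → (a , b)) (range1 n)) (range1 n)
  ; leq   = λ { (a , b) (c , d) → (a ≤ᵇ c) ∧ (b ≤ᵇ d) } }

-- all Boolean lists of a given length (= all subsets, as characteristic
-- vectors aligned with the enumeration of a poset)
allBits : ℕ → List (List Bool)
allBits zero    = [] ∷ []
allBits (suc m) = map (true ∷_) (allBits m) Data.List.++ map (false ∷_) (allBits m)

allᵇ : {A : Set} → (A → Bool) → List A → Bool
allᵇ p []       = true
allᵇ p (x ∷ xs) = p x ∧ allᵇ p xs

_⇒ᵇ_ : Bool → Bool → Bool
a ⇒ᵇ b = not a ∨ b

isDownClosed : (P : FinPoset) → List Bool → Bool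
isDownClosed P S =
  let xs = zip (elems P) S in
  allᵇ (λ { (x , bx) → allᵇ (λ { (y , by) → (leq P y x ∧ bx) ⇒ᵇ by }) xs }) xs

subsetᵇ : List Bool → List Bool → Bool
subsetᵇ S T = allᵇ (λ { (a , b) → a ⇒ᵇ b }) (zip S T)

DownSets : FinPoset → FinPoset
DownSets P = record
  { Elem  = List Bool
  ; elems = filter (λ S → T? (isDownClosed P S)) (allBits (length (elems P)))
  ; leq   = subsetᵇ }

Pfrom2 : ℕ → ℕ → FinPoset
Pfrom2 zero    n = grid n
Pfrom2 (suc j) n = DownSets (Pfrom2 j n)

-- P_r(n) for r ≥ 2 (the values for r < 2 are irrelevant)
𝒫 : ℕ → ℕ → FinPoset
𝒫 r n = Pfrom2 (r ∸ 2) n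

card : FinPoset → ℕ
card P = length (elems P)

data Color : Set where
  red blue : Color

-- A red/blue colored complete r-uniform hypergraph on the ordered vertex set
-- {0,…,N-1}: an edge {e_1 < … < e_r} is given by the increasing vector
-- (e_1,…,e_r); only values on edges (see IsEdge) are relevant.
Coloring : ℕ → Set
Coloring r = Vec ℕ r → Color

StrictIncOn : ℕ → (ℕ → ℕ) → Set
StrictIncOn m v = ∀ i j → i < j → j < m → v i < v j

BoundedOn : ℕ → ℕ → (ℕ → ℕ) → Set
BoundedOn m N v = ∀ i → i < m → v i < N

IsEdge : ∀ {r} → ℕ → Vec ℕ r → Set
IsEdge {r} N e =
  (∀ (i j : Fin r) → i F.< j → lookup e i < lookup e j) × (∀ i → lookup e i < N)

pathEdge : (r : ℕ) → (ℕ → ℕ) → ℕ → Vec ℕ r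
pathEdge r v i = tabulate (λ j → v (i + toℕ j))

MonoPath : (r N : ℕ) → Coloring r → Color → ℕ → Set
MonoPath r N c col k =
  Σ (ℕ → ℕ) λ v →
    StrictIncOn (k + r ∸ 1) v × BoundedOn (k + r ∸ 1) N v ×
    (∀ i → i < k → c (pathEdge r v i) ≡ col)

PathFree : (r N : ℕ) → Coloring r → ℕ → ℕ → Set
PathFree r N c k ℓ = ¬ MonoPath r N c red k × ¬ MonoPath r N c blue ℓ

Contains : (r M : ℕ) → Coloring r → (N : ℕ) → Coloring r → Set
Contains r M c⁺ N c =
  Σ (ℕ → ℕ) λ f →
    StrictIncOn N f × BoundedOn N M f ×
    (∀ (e : Vec ℕ r) → IsEdge N e → c⁺ (V.map f e) ≡ c e)

-- (k,ℓ)-path-saturated; a complete hypergraph properly contains (N, c)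
-- exactly when it contains it and has more vertices
PathSaturated : (r N : ℕ) → Coloring r → ℕ → ℕ → Set
PathSaturated r N c k ℓ =
  PathFree r N c k ℓ ×
  (∀ (M : ℕ) (c⁺ : Coloring r) → N < M → Contains r M c⁺ N c →
     MonoPath r M c⁺ red k ⊎ MonoPath r M c⁺ blue ℓ)

IsSatP : (r k ℓ s : ℕ) → Set
IsSatP r k ℓ s =
  (Σ (Coloring r) λ c → PathSaturated r s c k ℓ) ×
  (∀ (N : ℕ) (c : Coloring r) → PathSaturated r N c k ℓ → s ≤ N)

{-# OPTIONS --safe #-}
-- Call f a labelling of (d + 1)-tuples by a poset P if f (x₂, …, x_{d+2}) ≰ f (x₁, …, x_{d+1}) along
-- every edge. An (n, n)-path-free coloring yields a labelling of (r − 1)-tuples by [n]²: the lengths of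
-- the longest red and blue paths ending at a tuple. A labelling f of (d + 1)-tuples by P yields one of
-- d-tuples by the down-sets of P, sending x to the down-set generated by all f (y, x). After r − 2 such
-- steps the vertices are labelled injectively by 𝒫 r n, so there are at most |𝒫 r n| of them.
-- If there are fewer, some label p is unused; a new vertex labelled p can be inserted, and the extended
-- labelling is pulled back step by step, since a labelling g by down-sets of P gives one by P through
-- choosing f (e) ∈ g (tail e) ∖ g (front e). At the end [n]²-labels determine colors of the new edges.
-- Hence a path-free coloring on fewer than |𝒫 r n| vertices is never saturated.
module Submission where

open import Defs
open import Data.Bool using (Bool; true; false; _∧_)
open import Data.Bool.Properties using (T?; T-≡; T-∧)
import Data.Bool.Properties as Bool
open import Data.Empty using (⊥)
open import Data.Fin using (Fin; toℕ; fromℕ<)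
import Data.Fin as Fin
import Data.Fin.Properties as Fin
open import Data.List using (List; []; _∷_; length; zip; concatMap; cartesianProduct; _++_)
import Data.List as List
import Data.List.Properties as List
open import Data.List.Membership.Propositional using (_∈_)
open import Data.List.Membership.Propositional.Properties
  using (∈-map⁺; ∈-map⁻; ∈-filter⁺; ∈-filter⁻; ∈-++⁺ˡ; ∈-++⁺ʳ; ∈-++⁻; ∈-lookup;
         ∈-upTo⁺; ∈-upTo⁻; ∈-cartesianProduct⁺; ∈-cartesianProduct⁻)
import Data.List.Relation.Unary.All as ListAll
open import Data.List.Relation.Unary.AllPairs using ([]; _∷_)
open import Data.List.Relation.Unary.Any using (here; there; index)
open import Data.List.Relation.Unary.Any.Properties using (lookup-index)
open import Data.List.Relation.Unary.Unique.Propositional using (Unique)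
import Data.List.Relation.Unary.Unique.Propositional.Properties as Unique
open import Data.Nat using (ℕ; zero; suc; pred; _+_; _∸_; _≤_; _<_; z≤n; s≤s; _<?_; _≟_)
open import Data.Nat.Properties
open import Data.Product using (Σ; ∃; _×_; _,_; proj₁; proj₂)
import Data.Product.Properties as Product
open import Data.Sum using (_⊎_; inj₁; inj₂; [_,_])
open import Data.Unit using (⊤; tt)
open import Data.Vec using (Vec; []; _∷_; head; tail; map)
open import Data.Vec.Properties using (tabulate-cong)
import Data.Vec.Properties as Vec
open import Data.Vec.Relation.Unary.All using (All; []; _∷_; all?)
open import Function using (_∘_; Equivalence)
open import Relation.Binary using (DecidableEquality)
open import Relation.Binary.PropositionalEquality
  using (_≡_; _≢_; refl; sym; trans; cong; cong₂; subst; subst₂)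
open import Relation.Nullary using (¬_; Dec; yes; no; does; ¬?; contradiction)
open import Relation.Nullary.Decidable using (_×-dec_; map′; dec-true; dec-false)
open import Relation.Unary using (Decidable)

-- Increasing tuples

front : {A : Set} {n : ℕ} → Vec A (suc n) → Vec A n
front {n = zero}  _        = []
front {n = suc n} (x ∷ xs) = x ∷ front xs

map-front : {A B : Set} (f : A → B) {n : ℕ} (e : Vec A (suc n)) → map f (front e) ≡ front (map f e)
map-front f {zero}  (_ ∷ []) = refl
map-front f {suc n} (x ∷ xs) = cong (f x ∷_) (map-front f xs)

tail-front : {A : Set} {n : ℕ} (e : Vec A (suc (suc n))) → tail (front e) ≡ front (tail e)
tail-front (x ∷ xs) = refl

-- Only the last entry is compared with N, since the order bounds the others; in this form passing
-- to the tail is a projection and consing is pairing.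
Increasing : (N : ℕ) {m : ℕ} → Vec ℕ m → Set
Increasing N []           = ⊤
Increasing N (x ∷ [])     = x < N
Increasing N (x ∷ y ∷ xs) = x < y × Increasing N (y ∷ xs)

head-< : ∀ {N m} (x : Vec ℕ (suc m)) → Increasing N x → head x < N
head-< (x ∷ [])     x<N          = x<N
head-< (x ∷ y ∷ xs) (x<y , incr) = <-trans x<y (head-< (y ∷ xs) incr)

tail-increasing : ∀ {N m} (e : Vec ℕ (suc m)) → Increasing N e → Increasing N (tail e)
tail-increasing (x ∷ [])     _          = tt
tail-increasing (x ∷ y ∷ xs) (_ , incr) = incr

front-increasing : ∀ {N m} (e : Vec ℕ (suc m)) → Increasing N e → Increasing N (front e)
front-increasing (x ∷ [])         _            = tt
front-increasing (x ∷ y ∷ [])     (x<y , y<N)  = <-trans x<y y<N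
front-increasing (x ∷ y ∷ z ∷ xs) (x<y , incr) = x<y , front-increasing (y ∷ z ∷ xs) incr

cons-increasing : ∀ {N m y} (x : Vec ℕ (suc m)) → y < head x → Increasing N x → Increasing N (y ∷ x)
cons-increasing (x ∷ xs) y<x incr = y<x , incr

increasing? : ∀ N {m} (x : Vec ℕ m) → Dec (Increasing N x)
increasing? N []           = yes tt
increasing? N (x ∷ [])     = x <? N
increasing? N (x ∷ y ∷ xs) = (x <? y) ×-dec increasing? N (y ∷ xs)

increasing-bounded : ∀ {N m} (x : Vec ℕ m) → Increasing N x → All (_< N) x
increasing-bounded []           _          = []
increasing-bounded (x ∷ [])     x<N        = x<N ∷ []
increasing-bounded (x ∷ y ∷ xs) incr       = head-< (x ∷ y ∷ xs) incr ∷ increasing-bounded (y ∷ xs) (proj₂ incr)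

anyVec? : ∀ N m {Q : Vec ℕ m → Set} → Decidable Q → Dec (∃ λ x → All (_< N) x × Q x)
anyVec? N zero    Q? = map′ (λ q → [] , [] , q) (λ { ([] , _ , q) → q }) (Q? [])
anyVec? N (suc m) Q? =
  map′ (λ { (x , x<N , xs , xs<N , q) → x ∷ xs , x<N ∷ xs<N , q })
       (λ { (x ∷ xs , x<N ∷ xs<N , q) → x , x<N , xs , xs<N , q })
       (anyUpTo? (λ x → anyVec? N m (λ xs → Q? (x ∷ xs))) N)

-- Inserting a new vertex q

skip : ℕ → ℕ → ℕ
skip zero    i       = suc i
skip (suc q) zero    = zero
skip (suc q) (suc i) = suc (skip q i)

-- Inverse to `skip q` away from q; the value at q itself is junk.
unskip : ℕ → ℕ → ℕ
unskip zero    i       = pred i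
unskip (suc q) zero    = zero
unskip (suc q) (suc i) = suc (unskip q i)

unskip-skip : ∀ q i → unskip q (skip q i) ≡ i
unskip-skip zero    i       = refl
unskip-skip (suc q) zero    = refl
unskip-skip (suc q) (suc i) = cong suc (unskip-skip q i)

skip-≢ : ∀ q i → skip q i ≢ q
skip-≢ (suc q) (suc i) eq = skip-≢ q i (suc-injective eq)

skip-unskip : ∀ q i → i ≢ q → skip q (unskip q i) ≡ i
skip-unskip zero    zero    i≢q = contradiction refl i≢q
skip-unskip zero    (suc i) i≢q = refl
skip-unskip (suc q) zero    i≢q = refl
skip-unskip (suc q) (suc i) i≢q = cong suc (skip-unskip q i (i≢q ∘ cong suc))

skip-mono-< : ∀ q {i j} → i < j → skip q i < skip q j
skip-mono-< zero                    i<j       = s≤s i<j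
skip-mono-< (suc q) {zero}  {suc j} i<j       = s≤s z≤n
skip-mono-< (suc q) {suc i} {suc j} (s≤s i<j) = s≤s (skip-mono-< q i<j)

unskip-mono-< : ∀ q {i j} → i ≢ q → j ≢ q → i < j → unskip q i < unskip q j
unskip-mono-< zero    {zero}          i≢q j≢q i<j       = contradiction refl i≢q
unskip-mono-< zero    {suc i} {suc j} i≢q j≢q (s≤s i<j) = i<j
unskip-mono-< (suc q) {zero}  {suc j} i≢q j≢q i<j       = s≤s z≤n
unskip-mono-< (suc q) {suc i} {suc j} i≢q j≢q (s≤s i<j) =
  s≤s (unskip-mono-< q (i≢q ∘ cong suc) (j≢q ∘ cong suc) i<j)

skip-≤ : ∀ q i → skip q i ≤ suc i
skip-≤ zero    i       = ≤-refl
skip-≤ (suc q) zero    = z≤n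
skip-≤ (suc q) (suc i) = s≤s (skip-≤ q i)

≤-skip : ∀ q i → i ≤ skip q i
≤-skip zero    i       = n≤1+n i
≤-skip (suc q) zero    = z≤n
≤-skip (suc q) (suc i) = s≤s (≤-skip q i)

unskip-< : ∀ {N} q i → q ≤ N → i ≢ q → i < suc N → unskip q i < N
unskip-< zero    zero    q≤N       i≢q i<sN       = contradiction refl i≢q
unskip-< zero    (suc i) q≤N       i≢q (s≤s i<N)  = i<N
unskip-< (suc q) zero    (s≤s q≤N) i≢q i<sN       = s≤s z≤n
unskip-< (suc q) (suc i) (s≤s q≤N) i≢q (s≤s i<sN) = s≤s (unskip-< q i q≤N (i≢q ∘ cong suc) i<sN)

Old : ℕ → {m : ℕ} → Vec ℕ m → Set
Old q = All (_≢ q)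

old? : ∀ q {m} (e : Vec ℕ m) → Dec (Old q e)
old? q = all? (λ i → ¬? (i ≟ q))

map-skip-old : ∀ q {m} (x : Vec ℕ m) → Old q (map (skip q) x)
map-skip-old q []       = []
map-skip-old q (i ∷ x) = skip-≢ q i ∷ map-skip-old q x

map-unskip-skip : ∀ q {m} (x : Vec ℕ m) → map (unskip q) (map (skip q) x) ≡ x
map-unskip-skip q []      = refl
map-unskip-skip q (i ∷ x) = cong₂ _∷_ (unskip-skip q i) (map-unskip-skip q x)

map-skip-unskip : ∀ q {m} {e : Vec ℕ m} → Old q e → map (skip q) (map (unskip q) e) ≡ e
map-skip-unskip q []          = refl
map-skip-unskip q (i≢q ∷ old) = cong₂ _∷_ (skip-unskip q _ i≢q) (map-skip-unskip q old)

unskip-increasing : ∀ {N} q {m} {e : Vec ℕ m} → q ≤ N → Old q e →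
                    Increasing (suc N) e → Increasing N (map (unskip q) e)
unskip-increasing q q≤N []                     _            = tt
unskip-increasing q q≤N (i≢q ∷ [])             i<N          = unskip-< q _ q≤N i≢q i<N
unskip-increasing q q≤N (i≢q ∷ old@(j≢q ∷ _)) (i<j , incr) =
  unskip-mono-< q i≢q j≢q i<j , unskip-increasing q q≤N old incr

module _ {A : Set} {m : ℕ} (q : ℕ) (f h : Vec ℕ m → A) where

  extend : Vec ℕ m → A
  extend e with old? q e
  ... | yes _ = f (map (unskip q) e)
  ... | no  _ = h e

  extend-skip : ∀ x → extend (map (skip q) x) ≡ f x
  extend-skip x with old? q (map (skip q) x)
  ... | yes _   = cong f (map-unskip-skip q x)
  ... | no ¬old = contradiction (map-skip-old q x) ¬old

  extend-new : ∀ e → ¬ Old q e → extend e ≡ h e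
  extend-new e ¬old with old? q e
  ... | yes old = contradiction old ¬old
  ... | no  _   = refl

  -- A tuple avoiding q is `map (skip q)` of its image under `unskip q`, which is again increasing
  -- and below N because q ≤ N. So B is inherited from f there, and the tuples through q carry the
  -- value of h.
  extend-elim : ∀ {N} (B : Vec ℕ m → A → Set) → q ≤ N →
                (∀ x → Increasing N x → B (map (skip q) x) (f x)) →
                (∀ e → Increasing (suc N) e → B e (h e)) →
                ∀ e → Increasing (suc N) e → B e (extend e)
  extend-elim B q≤N old new e incr with old? q e
  ... | yes o = subst (λ z → B z (f (map (unskip q) e))) (map-skip-unskip q o)
                      (old _ (unskip-increasing q q≤N o incr))
  ... | no _  = new e incr

-- Posets

-- Transitivity and antisymmetry are asked for on listed elements only: `subsetᵇ` compares through
-- `zip` and ignores whatever exceeds the shorter list, so both can fail for bit lists of different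
-- lengths.
record Lawful (P : FinPoset) : Set where
  field
    _≟ᴾ_    : DecidableEquality (Elem P)
    unique  : Unique (elems P)
    ⊑-refl  : ∀ x → leq P x x ≡ true
    ⊑-trans : ∀ {x y z} → x ∈ elems P → y ∈ elems P → z ∈ elems P →
              leq P x y ≡ true → leq P y z ≡ true → leq P x z ≡ true
    ⊑-antisym : ∀ {x y} → x ∈ elems P → y ∈ elems P →
                leq P x y ≡ true → leq P y x ≡ true → x ≡ y

open Lawful

∧-true : ∀ {a b} → a ∧ b ≡ true → a ≡ true × b ≡ true
∧-true {true} {true} _ = refl , refl

allᵇ⁺ : {A : Set} {p : A → Bool} (xs : List A) → (∀ {x} → x ∈ xs → p x ≡ true) → allᵇ p xs ≡ true
allᵇ⁺ []       h = refl
allᵇ⁺ (x ∷ xs) h rewrite h (here refl) = allᵇ⁺ xs (h ∘ there)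

allᵇ⁻ : {A : Set} {p : A → Bool} {xs : List A} → allᵇ p xs ≡ true → ∀ {x} → x ∈ xs → p x ≡ true
allᵇ⁻ all (here refl) = proj₁ (∧-true all)
allᵇ⁻ {p = p} {y ∷ _} all (there x∈) = allᵇ⁻ (proj₂ (∧-true {p y} all)) x∈

∈-zip-map⁻ : {A : Set} (D : A → Bool) (xs : List A) {x : A} {b : Bool} →
             (x , b) ∈ zip xs (List.map D xs) → x ∈ xs × b ≡ D x
∈-zip-map⁻ D (x ∷ xs) (here refl) = here refl , refl
∈-zip-map⁻ D (x ∷ xs) (there x∈)  with ∈-zip-map⁻ D xs x∈
... | x∈xs , eq = there x∈xs , eq

∈-zip-map⁺ : {A : Set} (D : A → Bool) {xs : List A} {x : A} →
             x ∈ xs → (x , D x) ∈ zip xs (List.map D xs)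
∈-zip-map⁺ D (here refl) = here refl
∈-zip-map⁺ D (there x∈)  = there (∈-zip-map⁺ D x∈)

subsetᵇ-refl : ∀ S → subsetᵇ S S ≡ true
subsetᵇ-refl []          = refl
subsetᵇ-refl (true ∷ S)  = subsetᵇ-refl S
subsetᵇ-refl (false ∷ S) = subsetᵇ-refl S

subsetᵇ-trans : ∀ S R U → length S ≡ length R → subsetᵇ S R ≡ true → subsetᵇ R U ≡ true → subsetᵇ S U ≡ true
subsetᵇ-trans []          _           _           _  _ _ = refl
subsetᵇ-trans (_ ∷ _)     (_ ∷ _)     []          _  _ _ = refl
subsetᵇ-trans (true ∷ S)  (true ∷ R)  (true ∷ U)  eq p q = subsetᵇ-trans S R U (suc-injective eq) p q
subsetᵇ-trans (false ∷ S) (true ∷ R)  (_ ∷ U)     eq p q =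
  subsetᵇ-trans S R U (suc-injective eq) p (proj₂ (∧-true q))
subsetᵇ-trans (false ∷ S) (false ∷ R) (_ ∷ U)     eq p q = subsetᵇ-trans S R U (suc-injective eq) p q

subsetᵇ-antisym : ∀ S R → length S ≡ length R → subsetᵇ S R ≡ true → subsetᵇ R S ≡ true → S ≡ R
subsetᵇ-antisym []          []          _  _ _ = refl
subsetᵇ-antisym (true ∷ S)  (true ∷ R)  eq p q = cong (true ∷_) (subsetᵇ-antisym S R (suc-injective eq) p q)
subsetᵇ-antisym (false ∷ S) (false ∷ R) eq p q = cong (false ∷_) (subsetᵇ-antisym S R (suc-injective eq) p q)

subsetᵇ-mem : {A : Set} (xs : List A) (S R : List Bool) → length R ≡ length xs → subsetᵇ S R ≡ true →
              ∀ {x} → (x , true) ∈ zip xs S → (x , true) ∈ zip xs R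
subsetᵇ-mem (x ∷ xs) (true ∷ S)  (true ∷ R) eq p (here refl) = here refl
subsetᵇ-mem (x ∷ xs) (true ∷ S)  (true ∷ R) eq p (there x∈)  = there (subsetᵇ-mem xs S R (suc-injective eq) p x∈)
subsetᵇ-mem (x ∷ xs) (false ∷ S) (_ ∷ R)    eq p (there x∈)  = there (subsetᵇ-mem xs S R (suc-injective eq) p x∈)

-- If S ⊆ R, the result is the junk value d.
firstDifference : {A : Set} → List A → List Bool → List Bool → A → A
firstDifference (x ∷ xs) (true ∷ S) (false ∷ R) d = x
firstDifference (x ∷ xs) (_ ∷ S)    (_ ∷ R)     d = firstDifference xs S R d
firstDifference _        _          _           d = d

firstDifference-∈ : {A : Set} (xs : List A) (S R : List Bool) (d : A) →
  length S ≡ length xs → length R ≡ length xs → subsetᵇ S R ≢ true →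
  let x = firstDifference xs S R d in x ∈ xs × (x , true) ∈ zip xs S × (x , false) ∈ zip xs R
firstDifference-∈ []       []          []          d eq eq′ S⊈R = contradiction refl S⊈R
firstDifference-∈ (x ∷ xs) (true ∷ S)  (false ∷ R) d eq eq′ S⊈R = here refl , here refl , here refl
firstDifference-∈ (x ∷ xs) (true ∷ S)  (true ∷ R)  d eq eq′ S⊈R
  with firstDifference-∈ xs S R d (suc-injective eq) (suc-injective eq′) S⊈R
... | a , b , c = there a , there b , there c
firstDifference-∈ (x ∷ xs) (false ∷ S) (true ∷ R)  d eq eq′ S⊈R
  with firstDifference-∈ xs S R d (suc-injective eq) (suc-injective eq′) S⊈R
... | a , b , c = there a , there b , there c
firstDifference-∈ (x ∷ xs) (false ∷ S) (false ∷ R) d eq eq′ S⊈R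
  with firstDifference-∈ xs S R d (suc-injective eq) (suc-injective eq′) S⊈R
... | a , b , c = there a , there b , there c

-- Subsets and down-sets as bit lists.

∈-allBits⁻ : ∀ m {S} → S ∈ allBits m → length S ≡ m
∈-allBits⁻ zero    (here refl) = refl
∈-allBits⁻ (suc m) S∈ with ∈-++⁻ (List.map (true ∷_) (allBits m)) S∈
... | inj₁ S∈₁ with ∈-map⁻ (true ∷_) S∈₁
...   | R , R∈ , refl = cong suc (∈-allBits⁻ m R∈)
∈-allBits⁻ (suc m) S∈ | inj₂ S∈₂ with ∈-map⁻ (false ∷_) S∈₂
...   | R , R∈ , refl = cong suc (∈-allBits⁻ m R∈)

∈-allBits⁺ : ∀ S → S ∈ allBits (length S)
∈-allBits⁺ []          = here refl
∈-allBits⁺ (true ∷ S)  = ∈-++⁺ˡ (∈-map⁺ (true ∷_) (∈-allBits⁺ S))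
∈-allBits⁺ (false ∷ S) = ∈-++⁺ʳ (List.map (true ∷_) (allBits (length S))) (∈-map⁺ (false ∷_) (∈-allBits⁺ S))

allBits-unique : ∀ m → Unique (allBits m)
allBits-unique zero    = ListAll.[] ∷ []
allBits-unique (suc m) =
  Unique.++⁺ (Unique.map⁺ List.∷-injectiveʳ (allBits-unique m))
             (Unique.map⁺ List.∷-injectiveʳ (allBits-unique m))
             disjoint
  where
  disjoint : ∀ {S} → ¬ (S ∈ List.map (true ∷_) (allBits m) × S ∈ List.map (false ∷_) (allBits m))
  disjoint (p , q) with ∈-map⁻ (true ∷_) p | ∈-map⁻ (false ∷_) q
  ... | _ , _ , refl | _ , _ , ()

-- Bit lists are aligned with `elems P`, so `(x , true)` in the zipped list stands for x ∈ S and
-- `(y , false)` for y ∉ S.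
DownClosed : (P : FinPoset) → List Bool → Set
DownClosed P S = ∀ {x y b} → (x , true) ∈ zip (elems P) S → (y , b) ∈ zip (elems P) S →
                 leq P y x ≡ true → b ≡ true

∈-DownSets⁻ : ∀ P {S} → S ∈ elems (DownSets P) → length S ≡ card P × DownClosed P S
∈-DownSets⁻ P {S} S∈ with ∈-filter⁻ (λ R → T? (isDownClosed P R)) {xs = allBits (card P)} S∈
... | S∈bits , closed = ∈-allBits⁻ (card P) S∈bits , down
  where
  down : DownClosed P S
  down {x} {y} {b} x∈ y∈ y⊑x with allᵇ⁻ (allᵇ⁻ (Equivalence.to T-≡ closed) x∈) y∈
  ... | eq rewrite y⊑x = eq

∈-DownSets⁺ : ∀ P {S} → length S ≡ card P → DownClosed P S → S ∈ elems (DownSets P)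
∈-DownSets⁺ P {S} len down =
  ∈-filter⁺ (λ R → T? (isDownClosed P R)) (subst (λ m → S ∈ allBits m) len (∈-allBits⁺ S))
    (Equivalence.from T-≡ (allᵇ⁺ zs (λ x∈ → allᵇ⁺ zs (λ y∈ → implication x∈ y∈))))
  where
  zs = zip (elems P) S
  implication : ∀ {x y bx by} → (x , bx) ∈ zs → (y , by) ∈ zs → ((leq P y x ∧ bx) ⇒ᵇ by) ≡ true
  implication {x} {y} {bx} x∈ y∈ with leq P y x in eq | bx
  ... | false | _     = refl
  ... | true  | false = refl
  ... | true  | true  = down x∈ y∈ eq

DownSets-lawful : ∀ P → Lawful (DownSets P)
DownSets-lawful P = record
  { _≟ᴾ_      = List.≡-dec Bool._≟_
  ; unique    = Unique.filter⁺ (λ S → T? (isDownClosed P S)) (allBits-unique (card P))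
  ; ⊑-refl    = subsetᵇ-refl
  ; ⊑-trans   = λ {S} {R} {U} S∈ R∈ U∈ → subsetᵇ-trans S R U (same-length S∈ R∈)
  ; ⊑-antisym = λ {S} {R} S∈ R∈ → subsetᵇ-antisym S R (same-length S∈ R∈)
  }
  where
  same-length : ∀ {S R} → S ∈ elems (DownSets P) → R ∈ elems (DownSets P) → length S ≡ length R
  same-length S∈ R∈ = trans (proj₁ (∈-DownSets⁻ P S∈)) (sym (proj₁ (∈-DownSets⁻ P R∈)))

-- The grid [n]².

elems-grid : ∀ n → elems (grid n) ≡ cartesianProduct (range1 n) (range1 n)
elems-grid n = go (range1 n)
  where
  go : ∀ xs → concatMap (λ a → List.map (λ b → (a , b)) (range1 n)) xs ≡ cartesianProduct xs (range1 n)
  go []       = refl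
  go (x ∷ xs) = cong (List.map (x ,_) (range1 n) ++_) (go xs)

∈-grid⁺ : ∀ n {a b} → a < n → b < n → (suc a , suc b) ∈ elems (grid n)
∈-grid⁺ n a<n b<n = subst (_ ∈_) (sym (elems-grid n))
  (∈-cartesianProduct⁺ (∈-map⁺ suc (∈-upTo⁺ a<n)) (∈-map⁺ suc (∈-upTo⁺ b<n)))

-- Indexing the two coordinates by colors lets one argument serve both red and blue.
coordinate : Color → ℕ × ℕ → ℕ
coordinate red  = proj₁
coordinate blue = proj₂

∈-grid⁻ : ∀ n {x} → x ∈ elems (grid n) → ∀ col → 1 ≤ coordinate col x × coordinate col x ≤ n
∈-grid⁻ n x∈ = λ { red → ∈-range1 (proj₁ x∈²) ; blue → ∈-range1 (proj₂ x∈²) }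
  where
  x∈² = ∈-cartesianProduct⁻ (range1 n) (range1 n) (subst (_ ∈_) (elems-grid n) x∈)
  ∈-range1 : ∀ {a} → a ∈ range1 n → 1 ≤ a × a ≤ n
  ∈-range1 a∈ with ∈-map⁻ suc a∈
  ... | _ , i∈ , refl = s≤s z≤n , ∈-upTo⁻ i∈

grid-⊑⁺ : ∀ n x y → (∀ col → coordinate col x ≤ coordinate col y) → leq (grid n) x y ≡ true
grid-⊑⁺ n x y le = Equivalence.to T-≡ (Equivalence.from T-∧ (≤⇒≤ᵇ (le red) , ≤⇒≤ᵇ (le blue)))

grid-⊑⁻ : ∀ n x y → leq (grid n) x y ≡ true → ∀ col → coordinate col x ≤ coordinate col y
grid-⊑⁻ n x y le with Equivalence.to T-∧ (Equivalence.from T-≡ le)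
... | p , q = λ { red → ≤ᵇ⇒≤ (proj₁ x) (proj₁ y) p ; blue → ≤ᵇ⇒≤ (proj₂ x) (proj₂ y) q }

grid-lawful : ∀ n → Lawful (grid n)
grid-lawful n = record
  { _≟ᴾ_      = Product.≡-dec _≟_ _≟_
  ; unique    = subst Unique (sym (elems-grid n)) (Unique.cartesianProduct⁺ range1-unique range1-unique)
  ; ⊑-refl    = λ x → grid-⊑⁺ n x x (λ _ → ≤-refl)
  ; ⊑-trans   = λ {x} {y} {z} _ _ _ p q →
      grid-⊑⁺ n x z (λ col → ≤-trans (grid-⊑⁻ n x y p col) (grid-⊑⁻ n y z q col))
  ; ⊑-antisym = λ {x} {y} _ _ p q →
      cong₂ _,_ (≤-antisym (grid-⊑⁻ n x y p red) (grid-⊑⁻ n y x q red))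
                (≤-antisym (grid-⊑⁻ n x y p blue) (grid-⊑⁻ n y x q blue))
  }
  where
  range1-unique : Unique (range1 n)
  range1-unique = Unique.map⁺ suc-injective (Unique.upTo⁺ n)

-- Labellings

-- For d = 0 the labels are distinct elements of P met in an order compatible with `leq`: a later
-- label is never below or equal to an earlier one.
record Labelling (N : ℕ) {d : ℕ} (P : FinPoset) (f : Vec ℕ (suc d) → Elem P) : Set where
  field
    member : ∀ x → Increasing N x → f x ∈ elems P
    ascent : ∀ e → Increasing N e → leq P (f (tail e)) (f (front e)) ≢ true

open Labelling

-- A witness f e ∈ g (tail e) ∖ g (front e) for each edge. It links two consecutive levels:
-- `profile` yields g from f, and `firstDifference` yields f from g.
Selects : (N : ℕ) {d : ℕ} (P : FinPoset) →
          (Vec ℕ (suc (suc d)) → Elem P) → (Vec ℕ (suc d) → List Bool) → Set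
Selects N P f g = ∀ e → Increasing N e →
  f e ∈ elems P × (f e , true) ∈ zip (elems P) (g (tail e)) × (f e , false) ∈ zip (elems P) (g (front e))

-- The middle tuple x = `tail (front e)` = `front (tail e)` satisfies f (front e) ∈ g x and f (tail
-- e) ∉ g x. Were f (tail e) below f (front e), down-closure would put it into g x.
selection-labelling : ∀ {N d P} {f : Vec ℕ (suc (suc d)) → Elem P} {g : Vec ℕ (suc d) → List Bool} →
                      (∀ x → Increasing N x → DownClosed P (g x)) → Selects N P f g → Labelling N P f
selection-labelling {P = P} {f} {g} down sel = record
  { member = λ e incr → proj₁ (sel e incr)
  ; ascent = λ e incr le →
      contradiction
        (down (tail (front e)) (tail-increasing (front e) (front-increasing e incr))
          (proj₁ (proj₂ (sel (front e) (front-increasing e incr))))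
          (subst (λ x → (f (tail e) , false) ∈ zip (elems P) (g x)) (sym (tail-front e))
            (proj₂ (proj₂ (sel (tail e) (tail-increasing e incr)))))
          le)
        (λ ())
  }

module _ (P : FinPoset) {d : ℕ} (f : Vec ℕ (suc (suc d)) → Elem P) where

  below? : ∀ (x : Vec ℕ (suc d)) p → Dec (∃ λ y → y < head x × leq P p (f (y ∷ x)) ≡ true)
  below? x p = anyUpTo? (λ y → leq P p (f (y ∷ x)) Bool.≟ true) (head x)

  -- The down-set generated by the labels of all tuples that extend x by one vertex on the left.
  profile : Vec ℕ (suc d) → List Bool
  profile x = List.map (does ∘ below? x) (elems P)

module _ {P : FinPoset} (L : Lawful P) {N d : ℕ} {f : Vec ℕ (suc (suc d)) → Elem P}
         (lab : Labelling N P f) where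

  profile-length : ∀ x → length (profile P f x) ≡ card P
  profile-length x = List.length-map (does ∘ below? P f x) (elems P)

  -- The first vertex v of e extends `tail e` to e itself, so f e lies in the profile of `tail e`.
  -- If it also lay in that of `front e`, below f (y ∷ front e) for some y < v, then y ∷ e would
  -- violate `ascent`.
  profile-selects : Selects N P f (profile P f)
  profile-selects e@(v ∷ x@(w ∷ _)) incr =
    fe∈ ,
    subst (λ b → (f e , b) ∈ zip (elems P) (profile P f (tail e)))
          (dec-true (below? P f (tail e) (f e)) (v , proj₁ incr , ⊑-refl L (f e)))
          (∈-zip-map⁺ (does ∘ below? P f (tail e)) fe∈) ,
    subst (λ b → (f e , b) ∈ zip (elems P) (profile P f (front e)))
          (dec-false (below? P f (front e) (f e))
            (λ { (y , y<v , le) → ascent lab (y ∷ e) (cons-increasing e y<v incr) le }))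
          (∈-zip-map⁺ (does ∘ below? P f (front e)) fe∈)
    where fe∈ = member lab e incr

  profile-∈ : ∀ x → Increasing N x → profile P f x ∈ elems (DownSets P)
  profile-∈ x incr = ∈-DownSets⁺ P (profile-length x) down
    where
    down : DownClosed P (profile P f x)
    down {p} {r} p∈ r∈ r⊑p
      with ∈-zip-map⁻ (does ∘ below? P f x) (elems P) p∈ | ∈-zip-map⁻ (does ∘ below? P f x) (elems P) r∈
    ... | p∈P , eq | r∈P , eq′ with below? P f x p | eq
    ...   | yes (y , y<x , le) | _ =
      trans eq′ (dec-true (below? P f x r)
        (y , y<x , ⊑-trans L r∈P p∈P (member lab (y ∷ x) (cons-increasing x y<x incr)) r⊑p le))

  -- The label f e separates the two profiles.
  profile-labelling : Labelling N (DownSets P) (profile P f)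
  profile-labelling = record
    { member = profile-∈
    ; ascent = λ e incr le →
        let _ , in-tail , not-in-front = profile-selects e incr
            in-front = subsetᵇ-mem (elems P) (profile P f (tail e)) (profile P f (front e))
                                   (profile-length (front e)) le in-tail
            D = does ∘ below? P f (front e)
        in contradiction (trans (proj₂ (∈-zip-map⁻ D (elems P) in-front))
                                (sym (proj₂ (∈-zip-map⁻ D (elems P) not-in-front))))
                         (λ ())
    }

-- Iterated down-sets and the bound on the number of vertices.

DownSets^ : ℕ → FinPoset → FinPoset
DownSets^ zero    P = P
DownSets^ (suc d) P = DownSets^ d (DownSets P)

DownSets^-DownSets : ∀ d P → DownSets^ d (DownSets P) ≡ DownSets (DownSets^ d P)
DownSets^-DownSets zero    P = refl
DownSets^-DownSets (suc d) P = DownSets^-DownSets d (DownSets P)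

-- `DownSets^` peels off its innermost application, matching the recursions that replace P by
-- `DownSets P` while lowering d; `Pfrom2` peels off the outermost one.
DownSets^-grid : ∀ d n → DownSets^ d (grid n) ≡ Pfrom2 d n
DownSets^-grid zero    n = refl
DownSets^-grid (suc d) n = trans (DownSets^-DownSets d (grid n)) (cong DownSets (DownSets^-grid d n))

-- Profiles bring d down to 0. There, more than `card P` vertices would give some i < j the same
-- label, and reflexivity would contradict `ascent` on this pair.
labelling-bound : ∀ {N} d {P} → Lawful P → {f : Vec ℕ (suc d) → Elem P} →
                  Labelling N P f → N ≤ card (DownSets^ d P)
labelling-bound (suc d) {P} L lab = labelling-bound d (DownSets-lawful P) (profile-labelling L lab)
labelling-bound {N} zero {P} L {f} lab with card P <? N
... | no  P≮N = ≮⇒≥ P≮N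
... | yes P<N = contradiction equal-labels (λ eq → ascent lab (toℕ i ∷ toℕ j ∷ []) (i<j , Fin.toℕ<n j)
                  (subst (λ z → leq P (f (toℕ j ∷ [])) z ≡ true) (sym eq) (⊑-refl L _)))
  where
  ∈P : ∀ (k : Fin N) → f (toℕ k ∷ []) ∈ elems P
  ∈P k = member lab (toℕ k ∷ []) (Fin.toℕ<n k)
  clash = Fin.pigeonhole P<N (index ∘ ∈P)
  i = proj₁ clash
  j = proj₁ (proj₂ clash)
  i<j = proj₁ (proj₂ (proj₂ clash))
  equal-labels : f (toℕ i ∷ []) ≡ f (toℕ j ∷ [])
  equal-labels = trans (lookup-index (∈P i))
    (trans (cong (List.lookup (elems P)) (proj₂ (proj₂ (proj₂ clash)))) (sym (lookup-index (∈P j))))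

-- Extending a labelling by one vertex.

lookup-injective : {A : Set} {xs : List A} → Unique xs →
                   ∀ {i j} → List.lookup xs i ≡ List.lookup xs j → i ≡ j
lookup-injective (x∉ ∷ u) {Fin.zero}  {Fin.zero}  eq = refl
lookup-injective (x∉ ∷ u) {Fin.zero}  {Fin.suc j} eq =
  contradiction eq (ListAll.lookup x∉ (∈-lookup j))
lookup-injective (x∉ ∷ u) {Fin.suc i} {Fin.zero}  eq =
  contradiction (sym eq) (ListAll.lookup x∉ (∈-lookup i))
lookup-injective (x∉ ∷ u) {Fin.suc i} {Fin.suc j} eq = cong Fin.suc (lookup-injective u eq)

-- If every entry of xs were some g i with i < N, choosing such an i for each position would inject
-- `Fin (length xs)` into `Fin N`, as xs has no duplicates.
missing-element : {A : Set} → DecidableEquality A → {xs : List A} → Unique xs →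
                  ∀ {N} (g : ℕ → A) → N < length xs → ∃ λ p → p ∈ xs × (∀ i → i < N → g i ≢ p)
missing-element {A} _≟ᴬ_ {xs} u {N} g N<xs with Fin.all? hit?
  where
  hit? : ∀ (k : Fin (length xs)) → Dec (∃ λ i → i < N × g i ≡ List.lookup xs k)
  hit? k = anyUpTo? (λ i → g i ≟ᴬ List.lookup xs k) N
... | yes hit = contradiction N<xs (≤⇒≯ (Fin.injective⇒≤ {f = preimage} preimage-injective))
  where
  preimage : Fin (length xs) → Fin N
  preimage k = fromℕ< (proj₁ (proj₂ (hit k)))
  preimage-injective : ∀ {k l} → preimage k ≡ preimage l → k ≡ l
  preimage-injective {k} {l} eq = lookup-injective u
    (trans (sym (proj₂ (proj₂ (hit k))))
      (trans (cong g (Fin.fromℕ<-injective _ _ (proj₁ (proj₂ (hit k))) (proj₁ (proj₂ (hit l))) eq))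
             (proj₂ (proj₂ (hit l)))))
... | no ¬hit with Fin.¬∀⟶∃¬ (length xs) _ (λ k → anyUpTo? (λ i → g i ≟ᴬ List.lookup xs k) N) ¬hit
...   | k , ¬hit-k = List.lookup xs k , ∈-lookup k , λ i i<N eq → ¬hit-k (i , i<N , eq)

-- The value q = N is the default when R fails everywhere below N; hence the guard q < N on R q.
least : {R : ℕ → Set} → Decidable R → ∀ N →
        ∃ λ q → q ≤ N × (∀ i → i < q → ¬ R i) × (q < N → R q)
least R? zero = zero , z≤n , (λ _ ()) , (λ ())
least R? (suc N) with least R? N
... | q , q≤N , before , at with q ≟ N
...   | no q≢N = q , m≤n⇒m≤1+n q≤N , before , λ _ → at (≤∧≢⇒< q≤N q≢N)
...   | yes refl with R? N
...     | yes RN = N , n≤1+n N , before , λ _ → RN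
...     | no ¬RN = suc N , ≤-refl , before′ , λ N<N → contradiction N<N (<-irrefl refl)
  where
  before′ : ∀ i → i < suc N → ¬ _
  before′ i (s≤s i≤N) with i ≟ N
  ... | yes refl = ¬RN
  ... | no i≢N   = before i (≤∧≢⇒< i≤N i≢N)

-- Old vertices are moved along `skip position`. Keeping the labels of old tuples is what later
-- allows old edges to keep their colors.
record Extension (N : ℕ) {d : ℕ} (P : FinPoset) (f : Vec ℕ (suc d) → Elem P) : Set where
  field
    position  : ℕ
    position≤ : position ≤ N
    label     : Vec ℕ (suc d) → Elem P
    labelling : Labelling (suc N) P label
    agrees    : ∀ x → label (map (skip position) x) ≡ f x

-- A label p not yet in use goes directly before the first vertex whose label is above p.
insert-vertex : ∀ {N P} → Lawful P → {f : Vec ℕ 1 → Elem P} → Labelling N P f →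
                N < card P → Extension N P f
insert-vertex {N} {P} L {f} lab N<P
  with missing-element (_≟ᴾ_ L) (unique L) (λ i → f (i ∷ [])) N<P
... | p , p∈ , unused with least (λ i → leq P p (f (i ∷ [])) Bool.≟ true) N
...   | q , q≤N , before , at = record
  { position  = q
  ; position≤ = q≤N
  ; label     = f⁺
  ; labelling = record
    { member = extend-elim q f (λ _ → p) (λ _ l → l ∈ elems P) q≤N (member lab) (λ _ _ → p∈)
    ; ascent = λ { (u ∷ v ∷ []) (u<v , v<sN) → ascending u v u<v v<sN }
    }
  ; agrees    = extend-skip q f (λ _ → p)
  }
  where
  f⁺ = extend q f (λ _ → p)

  at-q : f⁺ (q ∷ []) ≡ p
  at-q = extend-new q f (λ _ → p) (q ∷ []) (λ { (q≢q ∷ []) → q≢q refl })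

  at-old : ∀ {v} → v ≢ q → f⁺ (v ∷ []) ≡ f (unskip q v ∷ [])
  at-old {v} v≢q = subst (λ z → f⁺ (z ∷ []) ≡ f (unskip q v ∷ [])) (skip-unskip q v v≢q)
                         (extend-skip q f (λ _ → p) (unskip q v ∷ []))

  -- No label from q on is below p. Given f i ⊑ p ⊑ f q, the case i = q makes p a used label by
  -- antisymmetry, and i > q contradicts `ascent` on the pair q, i.
  above : ∀ i → q ≤ i → i < N → leq P (f (i ∷ [])) p ≢ true
  above i q≤i i<N le with q ≟ i
  ... | yes refl = unused i i<N (⊑-antisym L (member lab (i ∷ []) i<N) p∈ le (at i<N))
  ... | no  q≢i  = ascent lab (q ∷ i ∷ []) (≤∧≢⇒< q≤i q≢i , i<N)
    (⊑-trans L (member lab (i ∷ []) i<N) p∈ (member lab (q ∷ []) q<N) le (at q<N))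
    where q<N = ≤-<-trans q≤i i<N

  ascending : ∀ u v → u < v → v < suc N → leq P (f⁺ (v ∷ [])) (f⁺ (u ∷ [])) ≢ true
  ascending u v u<v v<sN le = separated (u ≟ q) (v ≟ q)
    where
    separated : Dec (u ≡ q) → Dec (v ≡ q) → ⊥
    separated (yes u≡q) (yes v≡q) = <-irrefl (trans u≡q (sym v≡q)) u<v
    -- From q < v = `skip q (unskip q v)` ≤ `suc (unskip q v)`, the old index of v is at least q.
    separated (yes refl) (no v≢q) =
      above (unskip q v)
        (≤-pred (≤-trans (subst (q <_) (sym (skip-unskip q v v≢q)) u<v) (skip-≤ q (unskip q v))))
        (unskip-< q v q≤N v≢q v<sN)
        (subst₂ (λ a b → leq P a b ≡ true) (at-old v≢q) at-q le)
    separated (no u≢q) (yes refl) =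
      before (unskip q u)
        (≤-<-trans (≤-skip q (unskip q u)) (subst (_< q) (sym (skip-unskip q u u≢q)) u<v))
        (subst₂ (λ a b → leq P a b ≡ true) at-q (at-old u≢q) le)
    separated (no u≢q) (no v≢q) =
      ascent lab (unskip q u ∷ unskip q v ∷ []) (unskip-mono-< q u≢q v≢q u<v , unskip-< q v q≤N v≢q v<sN)
        (subst₂ (λ a b → leq P a b ≡ true) (at-old v≢q) (at-old u≢q) le)

-- On old tuples g agrees with the profiles of f, so f still selects from g there; on tuples through
-- q, a selection is read off from g (tail e) ⊈ g (front e). `selection-labelling` turns the
-- combined selection into a labelling.
lift-extension : ∀ {N d P} → Lawful P → {f : Vec ℕ (suc (suc d)) → Elem P} → Labelling N P f →
                 Extension N (DownSets P) (profile P f) → Extension N P f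
lift-extension {N} {d} {P} L {f} lab E = record
  { position  = q
  ; position≤ = q≤N
  ; label     = extend q f choose
  ; labelling = selection-labelling {g = g} (λ x incr → proj₂ (∈-DownSets⁻ P (member g-lab x incr)))
      (extend-elim q f choose
        (λ e l → l ∈ elems P × (l , true) ∈ zip (elems P) (g (tail e)) × (l , false) ∈ zip (elems P) (g (front e)))
        q≤N old new)
  ; agrees    = extend-skip q f choose
  }
  where
  open Extension E using () renaming
    (position to q; position≤ to q≤N; label to g; labelling to g-lab; agrees to g-agrees)

  -- The default f e is never the outcome of a failed search on an increasing tuple, since
  -- `ascent g-lab` supplies a difference.
  choose : Vec ℕ (suc (suc d)) → Elem P
  choose e = firstDifference (elems P) (g (tail e)) (g (front e)) (f e)

  g-length : ∀ x → Increasing (suc N) x → length (g x) ≡ card P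
  g-length x incr = proj₁ (∈-DownSets⁻ P (member g-lab x incr))

  old : ∀ x → Increasing N x →
        f x ∈ elems P × (f x , true) ∈ zip (elems P) (g (tail (map (skip q) x)))
                      × (f x , false) ∈ zip (elems P) (g (front (map (skip q) x)))
  old x@(_ ∷ _) incr with profile-selects L lab x incr
  ... | ∈P , ∈tail , ∉front =
    ∈P ,
    subst (λ S → (f x , true) ∈ zip (elems P) S) (sym (g-agrees (tail x))) ∈tail ,
    subst (λ S → (f x , false) ∈ zip (elems P) S)
      (sym (trans (cong g (sym (map-front (skip q) x))) (g-agrees (front x)))) ∉front

  new : ∀ e → Increasing (suc N) e →
        choose e ∈ elems P × (choose e , true) ∈ zip (elems P) (g (tail e))
                           × (choose e , false) ∈ zip (elems P) (g (front e))
  new e incr = firstDifference-∈ (elems P) (g (tail e)) (g (front e)) (f e)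
    (g-length (tail e) (tail-increasing e incr)) (g-length (front e) (front-increasing e incr))
    (ascent g-lab e incr)

extend-labelling : ∀ {N} d {P} → Lawful P → {f : Vec ℕ (suc d) → Elem P} → Labelling N P f →
                   N < card (DownSets^ d P) → Extension N P f
extend-labelling zero        L lab N< = insert-vertex L lab N<
extend-labelling (suc d) {P} L lab N< =
  lift-extension L lab (extend-labelling d (DownSets-lawful P) (profile-labelling L lab) N<)

-- Paths

-- `pathEdge` as a recursion on the length, so that `tail` and `Increasing` compute on it.
window : (m : ℕ) → (ℕ → ℕ) → ℕ → Vec ℕ m
window zero    v i = []
window (suc m) v i = v i ∷ window m v (suc i)

front-window : ∀ m v i → front (window (suc m) v i) ≡ window m v i
front-window zero    v i = refl
front-window (suc m) v i = cong (v i ∷_) (front-window m v (suc i))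

window-suc : ∀ m v i → window m v (suc i) ≡ window m (v ∘ suc) i
window-suc zero    v i = refl
window-suc (suc m) v i = cong (v (suc i) ∷_) (window-suc m v (suc i))

pathEdge-window : ∀ m v i → pathEdge m v i ≡ window m v i
pathEdge-window zero    v i = refl
pathEdge-window (suc m) v i = cong₂ _∷_ (cong v (+-identityʳ i))
  (trans (tabulate-cong (λ j → cong v (+-suc i (toℕ j)))) (pathEdge-window m v (suc i)))

window-cong : ∀ m {v w} i → (∀ j → j < i + m → v j ≡ w j) → window m v i ≡ window m w i
window-cong zero    i v≗w = refl
window-cong (suc m) i v≗w = cong₂ _∷_
  (v≗w i (m<m+n i (s≤s z≤n)))
  (window-cong m (suc i) (λ j j< → v≗w j (subst (j <_) (sym (+-suc i m)) j<)))

window-increasing : ∀ {l N v} m i → StrictIncOn l v → BoundedOn l N v → i + m ≤ l → Increasing N (window m v i)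
window-increasing {l} zero          i incr bound i+m≤l = tt
window-increasing {l} (suc zero)    i incr bound i+m≤l = bound i (subst (_≤ l) (+-comm i 1) i+m≤l)
window-increasing {l} (suc (suc m)) i incr bound i+m≤l =
  incr i (suc i) ≤-refl (≤-trans (s≤s (m<m+n i (s≤s z≤n))) i+m≤l′) ,
  window-increasing (suc m) (suc i) incr bound i+m≤l′
  where i+m≤l′ = subst (_≤ l) (+-suc i (suc m)) i+m≤l

window-last-< : ∀ {N} m v i → Increasing N (window (suc m) v i) → v (i + m) < N
window-last-< zero    v i incr rewrite +-identityʳ i = incr
window-last-< (suc m) v i incr rewrite +-suc i m     = window-last-< m v (suc i) (proj₂ incr)

window-last-step : ∀ {N} m v i → Increasing N (window (suc (suc m)) v i) → v (i + m) < v (suc (i + m))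
window-last-step zero    v i incr rewrite +-identityʳ i = proj₁ incr
window-last-step (suc m) v i incr rewrite +-suc i m     = window-last-step m v (suc i) (proj₂ incr)

-- Indices beyond the end give 0.
nth : {m : ℕ} → Vec ℕ m → ℕ → ℕ
nth []       _       = 0
nth (x ∷ xs) zero    = x
nth (x ∷ xs) (suc i) = nth xs i

window-nth : ∀ {m} (x : Vec ℕ m) → window m (nth x) 0 ≡ x
window-nth []       = refl
window-nth (x ∷ xs) = cong (x ∷_) (trans (window-suc _ (nth (x ∷ xs)) 0) (window-nth xs))

nth-step : ∀ {N m} (x : Vec ℕ m) → Increasing N x → ∀ i → suc i < m → nth x i < nth x (suc i)
nth-step (x ∷ [])     _            _       (s≤s ())
nth-step (x ∷ y ∷ xs) (x<y , incr) zero    _         = x<y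
nth-step (x ∷ y ∷ xs) (x<y , incr) (suc i) (s≤s i<m) = nth-step (y ∷ xs) incr i i<m

nth-< : ∀ {N m} (x : Vec ℕ m) → Increasing N x → ∀ i → i < m → nth x i < N
nth-< x@(_ ∷ _)  incr zero    _         = head-< x incr
nth-< x@(_ ∷ xs) incr (suc i) (s≤s i<m) = nth-< xs (tail-increasing x incr) i i<m

window-snoc : ∀ m (u : Vec ℕ (suc m)) v i → front u ≡ window m v i → nth u m ≡ v (i + m) → window (suc m) v i ≡ u
window-snoc zero    (z ∷ [])     v i _  eq = cong (_∷ []) (sym (trans eq (cong v (+-identityʳ i))))
window-snoc (suc m) (z ∷ u) v i eq eq′ = cong₂ _∷_ (sym (Vec.∷-injectiveˡ eq))
  (window-snoc m u v (suc i) (Vec.∷-injectiveʳ eq) (trans eq′ (cong v (+-suc i m))))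

steps-increasing : ∀ {l v} → (∀ i → suc i < l → v i < v (suc i)) → StrictIncOn l v
steps-increasing step i (suc j) i<sj sj<l with i ≟ j
... | yes refl = step i sj<l
... | no  i≢j  = <-trans (steps-increasing step i j (≤∧≢⇒< (≤-pred i<sj) i≢j) (<-trans (n<1+n j) sj<l)) (step j sj<l)

module _ (v : ℕ → ℕ) (l z : ℕ) where

  append : ℕ → ℕ
  append i with i <? l
  ... | yes _ = v i
  ... | no  _ = z

  append-< : ∀ {i} → i < l → append i ≡ v i
  append-< {i} i<l with i <? l
  ... | yes _  = refl
  ... | no i≮l = contradiction i<l i≮l

  append-end : append l ≡ z
  append-end with l <? l
  ... | yes l<l = contradiction l<l (<-irrefl refl)
  ... | no _    = refl

-- Monochromatic paths ending at a given tuple.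

_≟ᶜ_ : DecidableEquality Color
red  ≟ᶜ red  = yes refl
red  ≟ᶜ blue = no λ ()
blue ≟ᶜ red  = no λ ()
blue ≟ᶜ blue = yes refl

path-length : ∀ d k → k + suc (suc d) ∸ 1 ≡ k + suc d
path-length d k = cong pred (+-suc k (suc d))

module _ {d : ℕ} (c : Coloring (suc (suc d))) (col : Color) where

  -- There is a monochromatic path of length k whose last d + 1 vertices form x.
  HasPath : ℕ → Vec ℕ (suc d) → Set
  HasPath zero    x = ⊤
  HasPath (suc k) x = ∃ λ y → y < head x × c (y ∷ x) ≡ col × HasPath k (y ∷ front x)

  hasPath? : ∀ k x → Dec (HasPath k x)
  hasPath? zero    x = yes tt
  hasPath? (suc k) x = anyUpTo? (λ y → (c (y ∷ x) ≟ᶜ col) ×-dec hasPath? k (y ∷ front x)) (head x)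

  -- With edges of size d + 2, a path of k edges has k + d + 1 vertices; for k = 0 these are the
  -- entries of x.
  record PathEndingAt (N k : ℕ) (x : Vec ℕ (suc d)) : Set where
    field
      vertex  : ℕ → ℕ
      step    : ∀ i → suc i < k + suc d → vertex i < vertex (suc i)
      bounded : BoundedOn (k + suc d) N vertex
      colored : ∀ i → i < k → c (window (suc (suc d)) vertex i) ≡ col
      end     : window (suc d) vertex k ≡ x

  -- The old path ends in y ∷ front x, so appending the last entry `nth x d` of x makes the last d +
  -- 2 vertices form y ∷ x. The last step, bound and color are read off this edge; the rest is
  -- inherited through `append-<`.
  snoc-path : ∀ {N k x} y → y < head x → Increasing N x → c (y ∷ x) ≡ col →
              PathEndingAt N k (y ∷ front x) → PathEndingAt N (suc k) x
  snoc-path {N} {k} {x} y y<x incr cyx π = record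
    { vertex  = w
    ; step    = λ i si<sl → step-w i (suc i ≟ l) (≤-pred si<sl)
    ; bounded = λ i i<sl → bounded-w i (i ≟ l) (≤-pred i<sl)
    ; colored = λ i i<sk → colored-w i (i ≟ k) (≤-pred i<sk)
    ; end     = cong tail last-edge
    }
    where
    open PathEndingAt π using () renaming (vertex to v)
    l = k + suc d
    w = append v l (nth x d)

    last-edge : window (suc (suc d)) w k ≡ y ∷ x
    last-edge = window-snoc (suc d) (y ∷ x) w k
      (trans (sym (PathEndingAt.end π)) (window-cong (suc d) k (λ j j<l → sym (append-< v l (nth x d) j<l))))
      (sym (append-end v l (nth x d)))

    last-increasing : Increasing N (window (suc (suc d)) w k)
    last-increasing = subst (Increasing N) (sym last-edge) (cons-increasing x y<x incr)

    step-w : ∀ i → Dec (suc i ≡ l) → suc i ≤ l → w i < w (suc i)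
    step-w i (yes si≡l) _ = subst (λ j → w j < w (suc j)) (suc-injective (sym (trans si≡l (+-suc k d))))
                                  (window-last-step d w k last-increasing)
    step-w i (no si≢l) si≤l = subst₂ _<_ (sym (append-< v l (nth x d) si≤l)) (sym (append-< v l (nth x d) si<l))
                                         (PathEndingAt.step π i si<l)
      where si<l = ≤∧≢⇒< si≤l si≢l

    bounded-w : ∀ i → Dec (i ≡ l) → i ≤ l → w i < N
    bounded-w i (yes refl) _   = window-last-< (suc d) w k last-increasing
    bounded-w i (no i≢l)   i≤l = subst (_< N) (sym (append-< v l (nth x d) i<l)) (PathEndingAt.bounded π i i<l)
      where i<l = ≤∧≢⇒< i≤l i≢l

    colored-w : ∀ i → Dec (i ≡ k) → i ≤ k → c (window (suc (suc d)) w i) ≡ col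
    colored-w i (yes refl) _   = trans (cong c last-edge) cyx
    colored-w i (no i≢k)   i≤k = trans
      (cong c (window-cong (suc (suc d)) i (λ j j< → append-< v l (nth x d)
        (<-≤-trans j< (subst (_≤ l) (sym (+-suc i (suc d))) (+-monoˡ-≤ (suc d) i<k))))))
      (PathEndingAt.colored π i i<k)
      where i<k = ≤∧≢⇒< i≤k i≢k

  path-ending-at : ∀ {N} k x → Increasing N x → HasPath k x → PathEndingAt N k x
  path-ending-at zero x incr _ = record
    { vertex  = nth x
    ; step    = nth-step x incr
    ; bounded = nth-< x incr
    ; colored = λ _ ()
    ; end     = window-nth x
    }
  path-ending-at (suc k) x incr (y , y<x , cyx , path) = snoc-path y y<x incr cyx
    (path-ending-at k (y ∷ front x) (front-increasing (y ∷ x) (cons-increasing x y<x incr)) path)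

  monoPath : ∀ {N} k x → Increasing N x → HasPath k x → MonoPath (suc (suc d)) N c col k
  monoPath {N} k x incr path =
    vertex ,
    subst (λ l → StrictIncOn l vertex) (sym (path-length d k)) (steps-increasing step) ,
    subst (λ l → BoundedOn l N vertex) (sym (path-length d k)) bounded ,
    λ i i<k → trans (cong c (pathEdge-window (suc (suc d)) vertex i)) (colored i i<k)
    where open PathEndingAt (path-ending-at k x incr path)

  -- Only finitely many tuples below N can end a path, so a search decides the alternative and
  -- actually produces the path.
  monoPath⊎ : ∀ N k → MonoPath (suc (suc d)) N c col k ⊎ (∀ x → Increasing N x → ¬ HasPath k x)
  monoPath⊎ N k with anyVec? N (suc d) (λ x → increasing? N x ×-dec hasPath? k x)
  ... | yes (x , _ , incr , path) = inj₁ (monoPath k x incr path)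
  ... | no ¬path = inj₂ (λ x incr path → ¬path (x , increasing-bounded x incr , incr , path))

-- Path lengths as grid labels.

greatest : {R : ℕ → Set} → Decidable R → ℕ → ℕ
greatest R? zero    = zero
greatest R? (suc k) with R? (suc k)
... | yes _ = suc k
... | no  _ = greatest R? k

greatest-≤ : {R : ℕ → Set} (R? : Decidable R) → ∀ k → greatest R? k ≤ k
greatest-≤ R? zero    = z≤n
greatest-≤ R? (suc k) with R? (suc k)
... | yes _ = ≤-refl
... | no  _ = m≤n⇒m≤1+n (greatest-≤ R? k)

-- R 0 covers the value 0 to which `greatest` falls back.
greatest-holds : {R : ℕ → Set} (R? : Decidable R) → R 0 → ∀ k → R (greatest R? k)
greatest-holds R? R0 zero    = R0
greatest-holds R? R0 (suc k) with R? (suc k)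
... | yes r = r
... | no  _ = greatest-holds R? R0 k

greatest-upper : {R : ℕ → Set} (R? : Decidable R) → ∀ k {j} → j ≤ k → R j → j ≤ greatest R? k
greatest-upper R? zero    j≤k r = j≤k
greatest-upper R? (suc k) {j} j≤k r with R? (suc k)
... | yes _ = j≤k
... | no ¬r with j ≟ suc k
...   | yes refl = contradiction r ¬r
...   | no j≢    = greatest-upper R? k (≤-pred (≤∧≢⇒< j≤k j≢)) r

-- The color of an edge names a coordinate that rises along it, as in the Erdős-Szekeres argument;
-- this links path-free colorings to labellings by the grid.
Respects : (N : ℕ) {d : ℕ} → Coloring (suc (suc d)) → (Vec ℕ (suc d) → ℕ × ℕ) → Set
Respects N c f = ∀ e → Increasing N e → coordinate (c e) (f (front e)) < coordinate (c e) (f (tail e))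

NoPaths : (N : ℕ) {d : ℕ} → Coloring (suc (suc d)) → ℕ → Set
NoPaths N c k = ∀ col x → Increasing N x → ¬ HasPath c col k x

-- Path lengths start at 0 but the entries of the grid at 1, hence the suc.
pathLabel : ∀ {d} → Coloring (suc (suc d)) → ℕ → Vec ℕ (suc d) → ℕ × ℕ
pathLabel c n x = suc (greatest (λ k → hasPath? c red k x) n) , suc (greatest (λ k → hasPath? c blue k x) n)

coordinate-pathLabel : ∀ {d} (c : Coloring (suc (suc d))) n x col →
                       coordinate col (pathLabel c n x) ≡ suc (greatest (λ k → hasPath? c col k x) n)
coordinate-pathLabel c n x red  = refl
coordinate-pathLabel c n x blue = refl

-- A longest path of color c e ending at `front e` is prolonged by e to one ending at `tail e`. The
-- cap n in `pathLabel` does not hide the gain, because paths of length n + 1 are excluded.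
pathLabel-respects : ∀ {N d} (c : Coloring (suc (suc d))) n → NoPaths N c (suc n) → Respects N c (pathLabel c n)
pathLabel-respects {N} c n free e@(y ∷ x@(_ ∷ _)) incr =
  subst₂ _<_ (sym (coordinate-pathLabel c n (front e) col)) (sym (coordinate-pathLabel c n x col))
    (s≤s (greatest-upper (λ k → hasPath? c col k x) n r<n longer))
  where
  col = c e
  front? = λ k → hasPath? c col k (front e)
  r = greatest front? n
  longer : HasPath c col (suc r) x
  longer = y , proj₁ incr , refl , greatest-holds front? tt n
  r<n : r < n
  r<n = ≤∧≢⇒< (greatest-≤ front? n) (λ r≡n → free col x (proj₂ incr)
          (subst (λ k → HasPath c col (suc k) x) r≡n longer))

respects-labelling : ∀ {N d n} {c : Coloring (suc (suc d))} {f : Vec ℕ (suc d) → ℕ × ℕ} →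
                     (∀ x → Increasing N x → f x ∈ elems (grid n)) → Respects N c f → Labelling N (grid n) f
respects-labelling {n = n} {c} {f} mem respects = record
  { member = mem
  ; ascent = λ e incr le → <⇒≱ (respects e incr) (grid-⊑⁻ n (f (tail e)) (f (front e)) le (c e))
  }

pathLabel-labelling : ∀ {N d} (c : Coloring (suc (suc d))) n → NoPaths N c (suc n) →
                      Labelling N (grid (suc n)) (pathLabel c n)
pathLabel-labelling c n free = respects-labelling {n = suc n} {c}
  (λ x _ → ∈-grid⁺ (suc n) (s≤s (greatest-≤ (λ k → hasPath? c red k x) n))
                           (s≤s (greatest-≤ (λ k → hasPath? c blue k x) n)))
  (pathLabel-respects c n free)

-- Along a path of color col, that coordinate starts at 1 or more and rises with each edge, so after
-- n edges it exceeds n and leaves the grid.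
respects-pathFree : ∀ {N d n} {c : Coloring (suc (suc d))} {f : Vec ℕ (suc d) → ℕ × ℕ} →
                    (∀ x → Increasing N x → f x ∈ elems (grid n)) → Respects N c f →
                    ∀ col → ¬ MonoPath (suc (suc d)) N c col n
respects-pathFree {N} {d} {n} {c} {f} mem respects col (v , incr , bound , colored) =
  <⇒≱ (climb n ≤-refl) (proj₂ (∈-grid⁻ n (mem (tuple n) (tuple-increasing n ≤-refl)) col))
  where
  length-eq = path-length d n
  incr′  = subst (λ l → StrictIncOn l v) length-eq incr
  bound′ = subst (λ l → BoundedOn l N v) length-eq bound
  tuple : ℕ → Vec ℕ (suc d)
  tuple = window (suc d) v
  tuple-increasing : ∀ i → i ≤ n → Increasing N (tuple i)
  tuple-increasing i i≤n = window-increasing (suc d) i incr′ bound′ (+-monoˡ-≤ (suc d) i≤n)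
  climb : ∀ i → i ≤ n → i < coordinate col (f (tuple i))
  climb zero    _   = proj₁ (∈-grid⁻ n (mem (tuple 0) (tuple-increasing 0 z≤n)) col)
  climb (suc i) i<n = ≤-<-trans (climb i (<⇒≤ i<n))
    (subst (λ t → coordinate col (f t) < coordinate col (f (tuple (suc i)))) (front-window (suc d) v i)
      (subst (λ a → coordinate a (f (front e)) < coordinate a (f (tail e)))
        (trans (cong c (sym (pathEdge-window (suc (suc d)) v i))) (colored i i<n))
        (respects e (window-increasing (suc (suc d)) i incr′ bound′
          (subst (_≤ n + suc d) (sym (+-suc i (suc d))) (+-monoˡ-≤ (suc d) i<n))))))
    where e = window (suc (suc d)) v i

-- Path-free colorings and the saturation number.

pathFree-noPaths : ∀ {N d} {c : Coloring (suc (suc d))} {k} → PathFree (suc (suc d)) N c k k → NoPaths N c k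
pathFree-noPaths {c = c} {k} (¬red , ¬blue) red  x incr = ¬red ∘ monoPath c red k x incr
pathFree-noPaths {c = c} {k} (¬red , ¬blue) blue x incr = ¬blue ∘ monoPath c blue k x incr

-- Serves both halves of the theorem: it builds a path-free coloring vertex by vertex, and it
-- refutes saturation below the claimed size.
extend-coloring : ∀ {N} d n (c : Coloring (suc (suc d))) → PathFree (suc (suc d)) N c (suc n) (suc n) →
  N < card (Pfrom2 d (suc n)) →
  Σ (Coloring (suc (suc d))) λ c⁺ →
    Contains (suc (suc d)) (suc N) c⁺ N c × PathFree (suc (suc d)) (suc N) c⁺ (suc n) (suc n)
extend-coloring {N} d n c free N< =
  extend q c paint ,
  (skip q , (λ i j i<j _ → skip-mono-< q i<j) , (λ i i<N → s≤s (≤-trans (skip-≤ q i) i<N)) ,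
   (λ e _ → extend-skip q c paint e)) ,
  respects-pathFree {c = extend q c paint} (member g-lab) respects red ,
  respects-pathFree {c = extend q c paint} (member g-lab) respects blue
  where
  f = pathLabel c n
  no-paths = pathFree-noPaths {c = c} free
  open Extension
    (extend-labelling d (grid-lawful (suc n)) (pathLabel-labelling c n no-paths)
      (subst (λ P → N < card P) (sym (DownSets^-grid d (suc n))) N<))
    using () renaming
    (position to q; position≤ to q≤N; label to g; labelling to g-lab; agrees to g-agrees)

  -- On an edge, g (tail e) ≰ g (front e) means that some coordinate rises; if the first does not,
  -- the second must, which justifies blue.
  paint : Coloring (suc (suc d))
  paint e with proj₁ (g (front e)) <? proj₁ (g (tail e))
  ... | yes _ = red
  ... | no  _ = blue

  Ascends : Vec ℕ (suc (suc d)) → Color → Set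
  Ascends e col = coordinate col (g (front e)) < coordinate col (g (tail e))

  -- Old edges keep a color that `paint` might not have chosen. It still names a rising coordinate,
  -- because g agrees with the path labels on old tuples.
  old : ∀ x → Increasing N x → Ascends (map (skip q) x) (c x)
  old x@(_ ∷ _) incr = subst₂ (λ s t → coordinate (c x) s < coordinate (c x) t)
    (sym (trans (cong g (sym (map-front (skip q) x))) (g-agrees (front x))))
    (sym (g-agrees (tail x)))
    (pathLabel-respects c n no-paths x incr)

  new : ∀ e → Increasing (suc N) e → Ascends e (paint e)
  new e incr with proj₁ (g (front e)) <? proj₁ (g (tail e))
  ... | yes lt = lt
  ... | no ≮red with proj₂ (g (front e)) <? proj₂ (g (tail e))
  ...   | yes lt = lt
  ...   | no ≮blue = contradiction
    (grid-⊑⁺ (suc n) (g (tail e)) (g (front e)) λ { red → ≮⇒≥ ≮red ; blue → ≮⇒≥ ≮blue })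
    (ascent g-lab e incr)

  respects : Respects (suc N) (extend q c paint) g
  respects = extend-elim q c paint Ascends q≤N old new

-- Starting from the empty hypergraph, `extend-coloring` applies as long as the number of vertices
-- is below the cardinality.
pathFree-coloring : ∀ d n N → N ≤ card (Pfrom2 d (suc n)) →
                    Σ (Coloring (suc (suc d))) λ c → PathFree (suc (suc d)) N c (suc n) (suc n)
pathFree-coloring d n zero _ = (λ _ → red) , no-path , no-path
  where
  no-path : ∀ {col} → ¬ MonoPath (suc (suc d)) 0 (λ _ → red) col (suc n)
  no-path (v , _ , bound , _) with bound 0 (subst (0 <_) (sym (+-suc n (suc d))) (s≤s z≤n))
  ... | ()
pathFree-coloring d n (suc N) N< with pathFree-coloring d n N (<⇒≤ N<)
... | c , free with extend-coloring d n c free N<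
...   | c⁺ , _ , free⁺ = c⁺ , free⁺

-- If both paths were absent, the path labels would be a labelling by the grid, and
-- `labelling-bound` would give M ≤ `card (Pfrom2 d (suc n))`. This makes any path-free coloring on
-- exactly that many vertices saturated.
path-exists : ∀ d n {M} (c : Coloring (suc (suc d))) → card (Pfrom2 d (suc n)) < M →
              MonoPath (suc (suc d)) M c red (suc n) ⊎ MonoPath (suc (suc d)) M c blue (suc n)
path-exists d n {M} c <M with monoPath⊎ c red M (suc n) | monoPath⊎ c blue M (suc n)
... | inj₁ path  | _         = inj₁ path
... | inj₂ _     | inj₁ path = inj₂ path
... | inj₂ ¬red  | inj₂ ¬blue = contradiction <M (≤⇒≯ (subst (λ P → M ≤ card P) (DownSets^-grid d (suc n))
  (labelling-bound d (grid-lawful (suc n)) (pathLabel-labelling c n λ { red → ¬red ; blue → ¬blue }))))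

theorem7 : ∀ (r n : ℕ) → 2 ≤ r → 1 ≤ n → IsSatP r n n (card (𝒫 r n))
theorem7 (suc (suc d)) (suc n) (s≤s (s≤s z≤n)) (s≤s z≤n) =
  (c , free , λ M c⁺ <M _ → path-exists d n c⁺ <M) , minimal
  where
  existence = pathFree-coloring d n (card (Pfrom2 d (suc n))) ≤-refl
  c = proj₁ existence
  free = proj₂ existence
  minimal : ∀ N (c′ : Coloring (suc (suc d))) → PathSaturated (suc (suc d)) N c′ (suc n) (suc n) →
            card (Pfrom2 d (suc n)) ≤ N
  -- A smaller saturated hypergraph would have a path-free extension by one vertex, against its
  -- saturation.
  minimal N c′ (free′ , saturated) = ≮⇒≥ λ N< →
    let c⁺ , contains , ¬red , ¬blue = extend-coloring d n c′ free′ N<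
    in [ ¬red , ¬blue ] (saturated (suc N) c⁺ ≤-refl contains)
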